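{- Let $n\ge 3$ be an integer. For every integer $\ell$ with $2\leq \ell \leq n-1$, $e_n(n,\ell,n-1)=n-1$.
   Context: All graphs are finite, simple and undirected; $e(G)$ is the number of edges of $G$ and $\Delta(G)$ its maximum degree. For a graph $G$ and a nonempty set $S\subseteq V(G)$, the Steiner distance $d_G(S)$ is the minimum number of edges of a connected subgraph of $G$ whose vertex set contains $S$, with $d_G(S)=\infty$ if there is no such subgraph. For $2\le k\le n=|V(G)|$, the Steiner $k$-diameter is $sdiam_k(G)=\max\{d_G(S) : S\subseteq V(G),\ |S|=k\}$ (so it is $\infty$ if some $k$-set lies in no connected subgraph). For natural numbers $n,\ell,d$ with $\ell<n$ and $d<n$, $\mathscr{H}_k(n,\ell,d)$ is the set of all graphs $G$ of order $n$ with maximum degree exactly $\ell$ and $sdiam_k(G)\le d$, and $e_k(n,\ell,d)=\min\{e(G): G\in\mathscr{H}_k(n,\ell,d)\}$, with $e_k(n,\ell,d)=\infty$ if $\mathscr{H}_k(n,\ell,d)$ is empty. -}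

module Defs where

open import Data.Bool.Base using (Bool; T)
open import Data.Fin.Base using (Fin)
open import Data.Fin.Properties using (_<?_)
open import Data.Fin.Subset using (Subset; _∈_; _⊆_; ∣_∣)
open import Data.List.Base using (List; allFin; cartesianProduct; filter; length)
open import Data.Nat.Base using (ℕ; _≤_; _⊔_)
open import Data.Product.Base using (Σ-syntax; ∃-syntax; _×_; _,_)
open import Data.Vec.Base using (tabulate)
open import Data.Vec.Functional using (foldr)
open import Relation.Binary.Construct.Closure.ReflexiveTransitive using (Star)
open import Relation.Binary.PropositionalEquality.Core using (_≡_)
open import Relation.Nullary.Decidable.Core using (T?; _×-dec_)
open import Relation.Nullary.Negation.Core using (¬_)
open import Relation.Nullary.Construct.Add.Supremum using (_⁺; [_]; ⊤⁺)
open import Relation.Binary.Construct.Add.Supremum.NonStrict _≤_ using (_≤⁺_)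

record Graph (n : ℕ) : Set where
  field
    adj    : Fin n → Fin n → Bool
    sym    : ∀ u v → T (adj u v) → T (adj v u)
    irrefl : ∀ v → ¬ T (adj v v)

  Adj : Fin n → Fin n → Set
  Adj u v = T (adj u v)

  -- Each undirected edge is listed once, smaller endpoint first.
  edges : List (Fin n × Fin n)
  edges = filter (λ (u , v) → (u <? v) ×-dec T? (adj u v))
                 (cartesianProduct (allFin n) (allFin n))

  e : ℕ
  e = length edges

  degree : Fin n → ℕ
  degree v = ∣ tabulate (adj v) ∣

  Δ : ℕ
  Δ = foldr _⊔_ 0 degree

open Graph public using (Adj; e; Δ)

-- The edge set of a subgraph is stored as a graph on all of Fin n; vertices
-- outside `vertices` do not belong to the subgraph.
record Subgraph {n : ℕ} (G : Graph n) : Set where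
  field
    vertices : Subset n
    graph    : Graph n
    edges⊆   : ∀ u v → Adj graph u v → Adj G u v
    incident : ∀ u v → Adj graph u v → u ∈ vertices × v ∈ vertices

open Subgraph public using (vertices; graph)

Connected : {n : ℕ} {G : Graph n} → Subgraph G → Set
Connected H = ∀ u v → u ∈ vertices H → v ∈ vertices H → Star (Adj (graph H)) u v

ℕ∞ : Set
ℕ∞ = ℕ ⁺

-- Minima and maxima are relations rather than functions: `IsMin P x` reads
-- "min { m | P m } = x", where the minimum of the empty set is ∞ = ⊤⁺.
IsMin : (ℕ → Set) → ℕ∞ → Set
IsMin P [ m ] = P m × (∀ j → P j → m ≤ j)
IsMin P ⊤⁺    = ∀ j → ¬ P j

IsMax : (ℕ∞ → Set) → ℕ∞ → Set
IsMax P x = P x × (∀ y → P y → y ≤⁺ x)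

-- d_G(S) = x, for nonempty S.
IsSteinerDistance : {n : ℕ} → Graph n → Subset n → ℕ∞ → Set
IsSteinerDistance G S = IsMin λ m →
  Σ[ H ∈ Subgraph G ] Connected H × S ⊆ vertices H × e (graph H) ≡ m

-- sdiam_k(G) = x, for 2 ≤ k ≤ n.
IsSteinerDiameter : {n : ℕ} → ℕ → Graph n → ℕ∞ → Set
IsSteinerDiameter {n} k G = IsMax λ x →
  Σ[ S ∈ Subset n ] ∣ S ∣ ≡ k × IsSteinerDistance G S x

-- G ∈ ℋ_k(n, ℓ, d), i.e. Δ(G) = ℓ and sdiam_k(G) ≤ d.
ℋ : (k n ℓ d : ℕ) → Graph n → Set
ℋ k n ℓ d G = Δ G ≡ ℓ × ∃[ x ] IsSteinerDiameter k G x × x ≤⁺ [ d ]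

-- e_k(n, ℓ, d) = x, for ℓ < n and d < n.
IsMinSize : (k n ℓ d : ℕ) → ℕ∞ → Set
IsMinSize k n ℓ d = IsMin λ m → Σ[ G ∈ Graph n ] ℋ k n ℓ d G × e G ≡ m

{-# OPTIONS --safe #-}
-- A connected graph on m + 1 vertices has at least m edges: contracting one
-- edge loses one vertex and at most one edge.  Hence the Steiner n-distance of
-- the full vertex set is at least n - 1, with equality for trees.  The bound
-- is attained by the tree on 0, …, n - 1 in which the parent of v > 0 is v ∸ ℓ:
-- the root has the ℓ children 1, …, ℓ and any other vertex has at most one.
module Submission where

open import Defs
open import Data.Bool.Base using (Bool; true; false; T; _∨_)
open import Data.Bool.Properties using (T-∨; T-≡; ∨-comm; ∨-identityʳ)
open import Data.Fin.Base as Fin using (Fin; zero; suc; toℕ; fromℕ<; punchIn; punchOut)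
open import Data.Fin.Properties as Fin
  using (_≟_; toℕ-fromℕ<; toℕ<n; toℕ-injective; punchIn-punchOut; injective⇒≤)
open import Data.Fin.Subset using (Subset; inside; outside; _∈_; ⊤; ⁅_⁆; ∣_∣; _∪_)
open import Data.Fin.Subset.Properties
  using (∈⊤; ∣⊤∣≡n; ∣⊥∣≡0; ∣⁅x⁆∣≡1; ∣p∣≡n⇒p≡⊤; x∈⁅x⁆; x∈p∪q⁺; p⊆q⇒∣p∣≤∣q∣; nonempty?; Empty-unique)
open import Data.List.Base using (List; []; _∷_; allFin; cartesianProduct; length; lookup; map)
open import Data.List.Membership.Propositional using () renaming (_∈_ to _∈ˡ_)
open import Data.List.Membership.Propositional.Properties
  using (∈-allFin; ∈-cartesianProduct⁺; ∈-filter⁺; ∈-filter⁻; ∈-lookup)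
open import Data.List.Properties using (length-map)
open import Data.List.Relation.Unary.All as All using (All; []; _∷_)
open import Data.List.Relation.Unary.All.Properties using (map⁻)
open import Data.List.Relation.Unary.AllPairs.Core using (_∷_)
open import Data.List.Relation.Unary.Unique.Propositional using (Unique)
open import Data.List.Relation.Unary.Unique.Propositional.Properties
  using (allFin⁺; cartesianProduct⁺; filter⁺)
open import Data.Nat.Base using (ℕ; zero; suc; _+_; _∸_; _≤_; _<_; _<ᵇ_; _⊔_; z≤n; s≤s)
open import Data.Nat.Induction using (<-rec)
open import Data.Nat.Properties as ℕ
  using (≤-trans; ≤-reflexive; ≤-refl; ≤-antisym; <⇒≤; n≤1+n; +-suc; +-mono-≤; +-monoʳ-≤; 0≢1+n;
         ⊔-lub; m≤m⊔n; m∸n≤m; m∸n≡0⇒m≤n; m≤n⇒m∸n≡0; m∸n≢0⇒n<m; ∸-cancelʳ-≡)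
open import Data.Product.Base using (Σ-syntax; ∃-syntax; _×_; _,_; proj₁; proj₂)
open import Data.Sum.Base using (inj₁; inj₂; [_,_]′)
open import Data.Vec.Base using ([]; _∷_; tabulate)
open import Data.Vec.Functional using (foldr; insertAt)
open import Data.Vec.Functional.Properties using (insertAt-lookup; insertAt-punchIn)
open import Data.Vec.Properties using (lookup∘tabulate; lookup⇒[]=; []=⇒lookup; tabulate-cong)
open import Function.Base using (_∘_; id)
open import Function.Bundles using (mk⇔; module Equivalence)
open import Relation.Binary.Construct.Add.Supremum.NonStrict _≤_ using (_≤⁺_; [_])
open import Relation.Binary.Construct.Closure.ReflexiveTransitive as Star using (Star; ε; _◅_; _◅◅_)
open import Relation.Binary.Definitions using (tri<; tri≈; tri>)
open import Relation.Binary.PropositionalEquality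
  using (_≡_; refl; sym; trans; cong; subst)
open import Relation.Nullary.Construct.Add.Supremum using ([_]; ⊤⁺)
open import Relation.Nullary.Decidable using (yes; no; isYes; isYes≗does; toWitness; fromWitness; T?; _×-dec_; does-⇔)
open import Relation.Nullary.Negation using (¬_; contradiction)

-- Edge count of connected graphs.

ConstantOn : {n : ℕ} → List (Fin n × Fin n) → (Fin n → Bool) → Set
ConstantOn es g = All (λ (u , v) → g u ≡ g v) es

-- The hypothesis expresses connectedness: a vertex 2-colouring that is constant
-- on every edge is constant.
m≤∣edges∣ : ∀ {m} (es : List (Fin (suc m) × Fin (suc m))) →
            (∀ g → ConstantOn es g → ∀ x y → g x ≡ g y) → m ≤ length es
m≤∣edges∣ {zero}  _        _    = z≤n
m≤∣edges∣ {suc m} []       conn =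
  -- With no edges every colouring is admissible, and at least two vertices remain to be separated.
  contradiction (conn (λ { zero → true ; (suc _) → false }) [] zero (suc zero)) λ ()
m≤∣edges∣ {suc m} ((u , v) ∷ es) conn =
  let (u′ , same) = image in
  s≤s (subst (m ≤_) (length-map (contractEdge u′) es)
        (m≤∣edges∣ (map (contractEdge u′) es) λ g const x y →
          -- Pull `g` back along the contraction: the pullback respects the removed edge by `same`
          -- and the others by `const`. Since `punchIn u` is a section of the contraction, constancy
          -- descends to `g`.
          trans (sym (cong g (insertAt-punchIn id u u′ x)))
          (trans (conn (g ∘ contract u′) (cong g same ∷ map⁻ const) (punchIn u x) (punchIn u y))
                 (cong g (insertAt-punchIn id u u′ y)))))
  where
  -- Vertex `u` is sent to `u′`; every other vertex is renumbered by undoing `punchIn u`.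
  contract : Fin (suc m) → Fin (suc (suc m)) → Fin (suc m)
  contract u′ = insertAt id u u′

  contractEdge : Fin (suc m) → Fin (suc (suc m)) × Fin (suc (suc m)) → Fin (suc m) × Fin (suc m)
  contractEdge u′ (x , y) = contract u′ x , contract u′ y

  image : ∃[ u′ ] contract u′ u ≡ contract u′ v
  image with u ≟ v
  -- The list may contain loops; for a loop any `u′` identifies the endpoints, so `zero` is an
  -- arbitrary choice.
  ... | yes refl = zero , refl
  ... | no  u≢v  = punchOut u≢v ,
    trans (insertAt-lookup id u (punchOut u≢v))
    (trans (sym (insertAt-punchIn id u (punchOut u≢v) (punchOut u≢v)))
           (cong (insertAt id u (punchOut u≢v)) (punchIn-punchOut u≢v)))

module _ {n : ℕ} (G : Graph n) where

  ∈-edges⁺ : ∀ {u v} → u Fin.< v → Adj G u v → (u , v) ∈ˡ Graph.edges G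
  ∈-edges⁺ {u} {v} u<v uv =
    ∈-filter⁺ (λ (u , v) → (u Fin.<? v) ×-dec T? (Graph.adj G u v))
      (∈-cartesianProduct⁺ (∈-allFin u) (∈-allFin v)) (u<v , uv)

  ∈-edges⁻ : ∀ {u v} → (u , v) ∈ˡ Graph.edges G → u Fin.< v × Adj G u v
  ∈-edges⁻ = proj₂ ∘ ∈-filter⁻ (λ (u , v) → (u Fin.<? v) ×-dec T? (Graph.adj G u v))
                       {xs = cartesianProduct (allFin n) (allFin n)}

  edges-unique : Unique (Graph.edges G)
  edges-unique = filter⁺ _ (cartesianProduct⁺ (allFin⁺ n) (allFin⁺ n))

  constantOn-edges : ∀ {g} → ConstantOn (Graph.edges G) g → ∀ u v → Adj G u v → g u ≡ g v
  constantOn-edges const u v uv with Fin.<-cmp u v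
  ... | tri< u<v _ _  = All.lookup const (∈-edges⁺ u<v uv)
  ... | tri≈ _ refl _ = refl
  ... | tri> _ _ v<u  = sym (All.lookup const (∈-edges⁺ v<u (Graph.sym G u v uv)))

-- A colouring constant on edges is constant along walks, so connectedness supplies the hypothesis
-- of `m≤∣edges∣`.
connected⇒m≤e : ∀ {m} (G : Graph (suc m)) → (∀ u v → Star (Adj G) u v) → m ≤ e G
connected⇒m≤e G conn = m≤∣edges∣ (Graph.edges G) λ g const x y →
  Star.gfold g _≡_ (λ {u} {v} uv → trans (constantOn-edges G const u v uv)) refl (conn x y)

-- Steiner diameter for k = n.

full-⊆⇒∈ : ∀ {n} {S W : Subset n} → ∣ S ∣ ≡ n → (∀ {x} → x ∈ S → x ∈ W) → ∀ x → x ∈ W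
full-⊆⇒∈ ∣S∣≡n S⊆W x = S⊆W (subst (x ∈_) (sym (∣p∣≡n⇒p≡⊤ ∣S∣≡n)) ∈⊤)

-- A finite diameter is attained at some `S` of full size, so the subgraph realising its Steiner
-- distance is connected and spanning; hence `G` is connected.
ℋ⇒m≤e : ∀ {m ℓ d} (G : Graph (suc m)) → ℋ (suc m) (suc m) ℓ d G → m ≤ e G
ℋ⇒m≤e G (_ , [ _ ] , ((S , ∣S∣≡n , (H , conn , S⊆H , _) , _) , _) , _) =
  connected⇒m≤e G λ u v →
    Star.map (Subgraph.edges⊆ H _ _) (conn u v (full-⊆⇒∈ ∣S∣≡n S⊆H u) (full-⊆⇒∈ ∣S∣≡n S⊆H v))
ℋ⇒m≤e G (_ , ⊤⁺ , _ , ())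

spanningSubgraph : ∀ {n} (G : Graph n) → Subgraph G
spanningSubgraph G = record
  { vertices = ⊤ ; graph = G ; edges⊆ = λ _ _ → id ; incident = λ _ _ _ → ∈⊤ , ∈⊤ }

-- `G` itself is a connected subgraph containing any `S`, which bounds every distance by `m`. For
-- `S = ⊤` each competitor spans, so it has at least `m` edges.
tree-steinerDiameter : ∀ {m} (G : Graph (suc m)) → (∀ u v → Star (Adj G) u v) → e G ≡ m →
                       IsSteinerDiameter (suc m) G [ m ]
tree-steinerDiameter {m} G conn e≡m =
  (⊤ , ∣⊤∣≡n (suc m) , witness , minimal) , maximal
  where
  witness : ∀ {S} → Σ[ H ∈ Subgraph G ] Connected H × (∀ {x} → x ∈ S → x ∈ vertices H) × e (graph H) ≡ m
  witness = spanningSubgraph G , (λ u v _ _ → conn u v) , (λ _ → ∈⊤) , e≡m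

  minimal : ∀ j → (Σ[ H ∈ Subgraph G ] Connected H × (∀ {x} → x ∈ ⊤ → x ∈ vertices H) × e (graph H) ≡ j) →
            m ≤ j
  minimal _ (H , connH , ⊤⊆H , refl) =
    connected⇒m≤e (graph H) λ u v → connH u v (⊤⊆H ∈⊤) (⊤⊆H ∈⊤)

  maximal : ∀ y → (Σ[ S ∈ Subset (suc m) ] ∣ S ∣ ≡ suc m × IsSteinerDistance G S y) → y ≤⁺ [ m ]
  maximal [ _ ] (S , _ , _ , least) = [ least m (witness {S}) ]
  maximal ⊤⁺    (S , _ , none)      = contradiction (witness {S}) (none m)

-- Trees given by a parent function.

lookup-injective : ∀ {A : Set} {xs : List A} → Unique xs → ∀ {i j} → lookup xs i ≡ lookup xs j → i ≡ j
lookup-injective (_ ∷ _)  {zero}  {zero}  _  = refl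
lookup-injective (x∉ ∷ _) {zero}  {suc j} eq = contradiction eq (All.lookup x∉ (∈-lookup j))
lookup-injective (x∉ ∷ _) {suc i} {zero}  eq = contradiction (sym eq) (All.lookup x∉ (∈-lookup i))
lookup-injective (_ ∷ u)  {suc i} {suc j} eq = cong suc (lookup-injective u eq)

-- Pigeonhole: distinct positions hold distinct entries, so the indices chosen by `cover` differ.
unique-covered⇒length≤ : ∀ {A : Set} {m} {xs : List A} (h : Fin m → A) → Unique xs →
                         (∀ {x} → x ∈ˡ xs → ∃[ i ] x ≡ h i) → length xs ≤ m
unique-covered⇒length≤ h unique cover =
  injective⇒≤ {f = λ k → proj₁ (cover (∈-lookup k))} λ {k} {k′} eq →
    lookup-injective unique
      (trans (proj₂ (cover (∈-lookup k))) (trans (cong h eq) (sym (proj₂ (cover (∈-lookup k′))))))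

-- The root is `zero`, and `suc i` has parent `parent i`. By `parent≤` parents are strictly smaller
-- than their children, which rules out loops and makes ascent to the root terminate.
module RootedTree {m : ℕ} (parent : Fin m → Fin (suc m)) (parent≤ : ∀ i → toℕ (parent i) ≤ toℕ i) where

  isParent : Fin (suc m) → Fin (suc m) → Bool
  isParent u zero    = false
  isParent u (suc i) = isYes (u ≟ parent i)

  isParent⁻ : ∀ {u v} → T (isParent u v) → ∃[ i ] u ≡ parent i × v ≡ suc i
  isParent⁻ {u} {suc i} p = i , toWitness p , refl

  isParent⁺ : ∀ i → T (isParent (parent i) (suc i))
  isParent⁺ i = fromWitness refl

  isParent⇒< : ∀ {u v} → T (isParent u v) → u Fin.< v
  isParent⇒< {u} {v} p with i , refl , refl ← isParent⁻ {u} {v} p = s≤s (parent≤ i)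

  ¬isParent-self : ∀ v → ¬ T (isParent v v)
  ¬isParent-self v = Fin.<-irrefl {x = v} refl ∘ isParent⇒<

  tree : Graph (suc m)
  tree = record
    { adj    = λ u v → isParent u v ∨ isParent v u
    ; sym    = λ u v → subst T (∨-comm (isParent u v) (isParent v u))
    ; irrefl = λ v vv → [ ¬isParent-self v , ¬isParent-self v ]′
                          (Equivalence.to T-∨ vv)
    }

  connected-to-root : ∀ k v → toℕ v ≡ k → Star (Adj tree) v zero
  connected-to-root = <-rec _ step
    where
    step : ∀ k → (∀ {j} → j < k → ∀ v → toℕ v ≡ j → Star (Adj tree) v zero) →
           ∀ v → toℕ v ≡ k → Star (Adj tree) v zero
    step _ rec zero    refl = ε
    step _ rec (suc i) refl =
      Equivalence.from T-∨ (inj₂ (isParent⁺ i)) ◅ rec (s≤s (parent≤ i)) (parent i) refl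

  tree-connected : ∀ u v → Star (Adj tree) u v
  tree-connected u v =
    connected-to-root _ u refl ◅◅ Star.reverse (λ {x} {y} → Graph.sym tree x y) (connected-to-root _ v refl)

  edge⇒parent : ∀ {x} → x ∈ˡ Graph.edges tree → ∃[ i ] x ≡ (parent i , suc i)
  edge⇒parent {u , v} x∈ with ∈-edges⁻ tree x∈
  ... | u<v , uv with Equivalence.to T-∨ uv
  ...   | inj₂ vu = contradiction (isParent⇒< {v} {u} vu) (Fin.<-asym {x = u} {v} u<v)
  ...   | inj₁ uv′ with i , refl , refl ← isParent⁻ {u} {v} uv′ = i , refl

  -- Each edge is determined by its child endpoint, one of the `m` non-root vertices; connectedness
  -- gives the reverse inequality.
  e-tree : e tree ≡ m
  e-tree = ≤-antisym (unique-covered⇒length≤ (λ i → parent i , suc i) (edges-unique tree) edge⇒parent)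
                     (connected⇒m≤e tree tree-connected)

-- Cardinalities of subsets.

∈-tabulate⁻ : ∀ {n} (f : Fin n → Bool) {x} → x ∈ tabulate f → T (f x)
∈-tabulate⁻ f {x} x∈ = Equivalence.from T-≡ (trans (sym (lookup∘tabulate f x)) ([]=⇒lookup x∈))

∈-tabulate⁺ : ∀ {n} (f : Fin n → Bool) {x} → T (f x) → x ∈ tabulate f
∈-tabulate⁺ f {x} fx = lookup⇒[]= x _ (trans (lookup∘tabulate f x) (Equivalence.to T-≡ fx))

∣p∪q∣≤∣p∣+∣q∣ : ∀ {n} (p q : Subset n) → ∣ p ∪ q ∣ ≤ ∣ p ∣ + ∣ q ∣
∣p∪q∣≤∣p∣+∣q∣ []            []            = z≤n
∣p∪q∣≤∣p∣+∣q∣ (outside ∷ p) (outside ∷ q) = ∣p∪q∣≤∣p∣+∣q∣ p q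
∣p∪q∣≤∣p∣+∣q∣ (outside ∷ p) (inside ∷ q)  =
  ≤-trans (s≤s (∣p∪q∣≤∣p∣+∣q∣ p q)) (≤-reflexive (sym (+-suc ∣ p ∣ ∣ q ∣)))
∣p∪q∣≤∣p∣+∣q∣ (inside ∷ p)  (outside ∷ q) = s≤s (∣p∪q∣≤∣p∣+∣q∣ p q)
∣p∪q∣≤∣p∣+∣q∣ (inside ∷ p)  (inside ∷ q)  =
  s≤s (≤-trans (∣p∪q∣≤∣p∣+∣q∣ p q) (+-monoʳ-≤ ∣ p ∣ (n≤1+n ∣ q ∣)))

subsingleton⇒∣p∣≤1 : ∀ {n} (p : Subset n) → (∀ {x y} → x ∈ p → y ∈ p → x ≡ y) → ∣ p ∣ ≤ 1
subsingleton⇒∣p∣≤1 {n} p prop with nonempty? p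
... | yes (x , x∈p) = ≤-trans
  (p⊆q⇒∣p∣≤∣q∣ λ y∈p → subst (_∈ ⁅ x ⁆) (prop x∈p y∈p) (x∈⁅x⁆ x)) (≤-reflexive (∣⁅x⁆∣≡1 x))
... | no  empty     = subst (λ q → ∣ q ∣ ≤ 1) (sym (Empty-unique empty)) (≤-trans (≤-reflexive (∣⊥∣≡0 n)) z≤n)

∣tabulate-<ᵇ∣ : ∀ {n k} → k ≤ n → ∣ tabulate {n = n} (λ i → toℕ i <ᵇ k) ∣ ≡ k
∣tabulate-<ᵇ∣ {zero}  z≤n       = refl
∣tabulate-<ᵇ∣ {suc n} z≤n       = ∣tabulate-<ᵇ∣ {n} z≤n
∣tabulate-<ᵇ∣ {suc n} (s≤s k≤n) = cong suc (∣tabulate-<ᵇ∣ k≤n)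

foldr-⊔-lub : ∀ {n b} (f : Fin n → ℕ) → (∀ i → f i ≤ b) → foldr _⊔_ 0 f ≤ b
foldr-⊔-lub {zero}  f f≤b = z≤n
foldr-⊔-lub {suc n} f f≤b = ⊔-lub (f≤b zero) (foldr-⊔-lub (f ∘ suc) (f≤b ∘ suc))

-- Degrees in the extremal tree.

-- Here ℓ = suc l, and the vertex v = suc i has parent v ∸ ℓ = i ∸ l.
module Broom {m l : ℕ} (1≤l : 1 ≤ l) (l<m : l < m) where

  parent<n : (i : Fin m) → toℕ i ∸ l < suc m
  parent<n i = s≤s (≤-trans (m∸n≤m (toℕ i) l) (<⇒≤ (toℕ<n i)))

  parent : Fin m → Fin (suc m)
  parent i = fromℕ< (parent<n i)

  toℕ-parent : ∀ i → toℕ (parent i) ≡ toℕ i ∸ l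
  toℕ-parent i = toℕ-fromℕ< (parent<n i)

  open RootedTree parent (λ i → ≤-trans (≤-reflexive (toℕ-parent i)) (m∸n≤m (toℕ i) l)) public

  -- Truncated subtraction gives `i ∸ l = 0` exactly when `i ≤ l`. The `false` is what
  -- `isParent (suc i) zero` reduces to.
  root-child : ∀ i → isParent zero (suc i) ∨ false ≡ (toℕ i <ᵇ suc l)
  root-child i = trans (∨-identityʳ _)
    (trans (isYes≗does (zero ≟ parent i))
           (does-⇔ (mk⇔ to from) (zero ≟ parent i) (toℕ i ℕ.<? suc l)))
    where
    to : zero ≡ parent i → toℕ i < suc l
    to eq = s≤s (m∸n≡0⇒m≤n (trans (sym (toℕ-parent i)) (cong toℕ (sym eq))))

    from : toℕ i < suc l → zero ≡ parent i
    from (s≤s i≤l) = toℕ-injective (sym (trans (toℕ-parent i) (m≤n⇒m∸n≡0 i≤l)))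

  degree-root : Graph.degree tree zero ≡ suc l
  -- The entry of the root at itself computes to `false`, and `l<m` ensures that all `suc l`
  -- children exist.
  degree-root = trans (cong ∣_∣ (tabulate-cong root-child)) (∣tabulate-<ᵇ∣ l<m)

  -- Subtracting `l` is injective on numbers at least `l`, and a nonzero parent `suc j` forces its
  -- children into that range.
  child-unique : ∀ {j x y} → T (isParent (suc j) x) → T (isParent (suc j) y) → x ≡ y
  child-unique {j} {x} {y} p q with isParent⁻ {suc j} {x} p | isParent⁻ {suc j} {y} q
  ... | i , eq , refl | k , eq′ , refl =
    cong suc (toℕ-injective (∸-cancelʳ-≡ (l≤ i eq) (l≤ k eq′)
      (trans (sym (toℕ-parent i)) (trans (cong toℕ (trans (sym eq) eq′)) (toℕ-parent k)))))
    where
    l≤ : ∀ i → suc j ≡ parent i → l ≤ toℕ i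
    l≤ i eq = <⇒≤ (m∸n≢0⇒n<m λ i∸l≡0 →
      0≢1+n (trans (sym i∸l≡0) (trans (sym (toℕ-parent i)) (cong toℕ (sym eq)))))

  degree-nonroot≤ : ∀ j → Graph.degree tree (suc j) ≤ 2
  degree-nonroot≤ j =
    ≤-trans (p⊆q⇒∣p∣≤∣q∣ neighbour⇒)
    (≤-trans (∣p∪q∣≤∣p∣+∣q∣ children parents)
    (+-mono-≤
      (subsingleton⇒∣p∣≤1 children λ x∈ y∈ →
        child-unique {j} (∈-tabulate⁻ (isParent (suc j)) x∈) (∈-tabulate⁻ (isParent (suc j)) y∈))
      (≤-reflexive (∣⁅x⁆∣≡1 (parent j)))))
    where
    children parents : Subset (suc m)
    children = tabulate (isParent (suc j))
    parents  = ⁅ parent j ⁆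

    neighbour⇒ : ∀ {x} → x ∈ tabulate (Graph.adj tree (suc j)) → x ∈ children ∪ parents
    neighbour⇒ {x} x∈ = x∈p∪q⁺
      ([ inj₁ ∘ ∈-tabulate⁺ (isParent (suc j))
       , (λ p → inj₂ (subst (_∈ parents) (sym (toWitness p)) (x∈⁅x⁆ (parent j)))) ]′
       (Equivalence.to T-∨ (∈-tabulate⁻ (Graph.adj tree (suc j)) x∈)))

  Δ-tree : Δ tree ≡ suc l
  Δ-tree = ≤-antisym
    (foldr-⊔-lub (Graph.degree tree) λ
      { zero    → ≤-reflexive degree-root
      -- This is where `2 ≤ ℓ` enters: one child and one parent do not exceed the root's degree.
      ; (suc j) → ≤-trans (degree-nonroot≤ j) (s≤s 1≤l) })
    (≤-trans (≤-reflexive (sym degree-root)) (m≤m⊔n (Graph.degree tree zero) _))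

proposition2p1 : (n : ℕ) → 3 ≤ n → (ℓ : ℕ) → 2 ≤ ℓ → ℓ ≤ n ∸ 1 → IsMinSize n n ℓ (n ∸ 1) [ n ∸ 1 ]
proposition2p1 (suc m) _ (suc l) (s≤s 1≤l) l<m =
  -- With `n = suc m` and `ℓ = suc l`, the bound `ℓ ≤ n ∸ 1` is by definition `l < m`, as `Broom`
  -- expects.
  (tree , (Δ-tree , [ m ] , tree-steinerDiameter tree tree-connected e-tree , [ ≤-refl ]) , e-tree) ,
  λ { _ (G , G∈ℋ , refl) → ℋ⇒m≤e G G∈ℋ }
  where open Broom 1≤l l<m
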